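{- For each integer $n\ge 3$, the cycle $C_n$ with $n$ vertices satisfies $$M(C_n)=\begin{cases}\dfrac{n^2-2n+4}{2} & \text{if } n\equiv 0\pmod 2,\\[2mm] n^2-n+1 & \text{otherwise.}\end{cases}$$
   Context: Graphs are finite, simple and undirected. For $n\ge3$, $C_n$ is the graph with vertex set $\{1,\dots,n\}$ and edge set $\{\{i,i+1\} : 1\le i\le n-1\}\cup\{\{1,n\}\}$. For a graph $\mathcal{G}$ with $n$ vertices and adjacency matrix $A$, viewed over $\mathbb{F}_2$, let $C(\mathcal{G})\subseteq\mathbb{F}_2^{2n}$ be the binary linear code generated by the rows of $[I_n|A]$, where $I_n$ is the $n\times n$ identity matrix. The support of a vector is the set of positions of its nonzero entries. A nonzero codeword $c$ of a binary linear code $C$ is minimal if there is no nonzero codeword $c'\in C$ with $\operatorname{supp}(c')\subsetneq\operatorname{supp}(c)$. $M(\mathcal{G})$ denotes the number of minimal codewords of $C(\mathcal{G})$; it does not depend on the labeling of the vertices. -}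

module Defs where

open import Data.Bool using (Bool; true; false; if_then_else_; _∧_; _xor_)
import Data.Bool.Properties as Bool
open import Data.Fin using (Fin; toℕ)
import Data.Fin.Properties as Fin
open import Data.Fin.Subset using (Subset; _⊂_)
open import Data.Fin.Subset.Properties using (_⊂?_; anySubset?)
open import Data.List using (List; []; _∷_; [_]; cartesianProductWith; filter; length)
open import Data.Nat using (ℕ; zero; suc; _+_; _≤_; s≤s)
import Data.Nat.Properties as ℕ
open import Data.Product using (∃; _×_; _,_)
open import Data.Sum using (_⊎_; inj₁; inj₂; swap)
open import Data.Vec using (Vec; []; _∷_; _++_; foldr′; map; replicate; tabulate; zipWith)
import Data.Vec.Properties as Vec
open import Level using (0ℓ)
open import Relation.Binary using (Rel; DecidableEquality; Symmetric) renaming (Decidable to Decidable₂)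
open import Relation.Binary.PropositionalEquality using (_≡_; _≢_; refl; sym)
open import Relation.Nullary using (¬_; ¬?; does; _×-dec_; _⊎-dec_)
open import Relation.Unary using (Pred; Decidable)

-- The field with two elements: addition is _xor_ and multiplication is _∧_
-- (compare Data.Bool.Properties.xor-∧-commutativeRing).
𝔽₂ : Set
𝔽₂ = Bool

pattern 0₂ = false
pattern 1₂ = true

𝔽₂^ : ℕ → Set
𝔽₂^ m = Vec 𝔽₂ m

Matrix : ℕ → ℕ → Set
Matrix k m = Vec (𝔽₂^ m) k

0ᵛ : ∀ {m} → 𝔽₂^ m
0ᵛ = replicate _ 0₂

infixl 6 _+ᵛ_
infixr 7 _·ᵛ_

_+ᵛ_ : ∀ {m} → 𝔽₂^ m → 𝔽₂^ m → 𝔽₂^ m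
_+ᵛ_ = zipWith _xor_

_·ᵛ_ : ∀ {m} → 𝔽₂ → 𝔽₂^ m → 𝔽₂^ m
a ·ᵛ v = map (a ∧_) v

_≟ᵛ_ : ∀ {m} → DecidableEquality (𝔽₂^ m)
_≟ᵛ_ = Vec.≡-dec Bool._≟_

linearCombination : ∀ {k m} → 𝔽₂^ k → Matrix k m → 𝔽₂^ m
linearCombination a rows = foldr′ _+ᵛ_ 0ᵛ (zipWith _·ᵛ_ a rows)

identity : ∀ n → Matrix n n
identity n = tabulate λ i → tabulate λ j → if does (i Fin.≟ j) then 1₂ else 0₂

infixr 5 _∣∣_

_∣∣_ : ∀ {k m n} → Matrix k m → Matrix k n → Matrix k (m + n)
_∣∣_ = zipWith _++_

Code : ℕ → Set₁
Code m = Pred (𝔽₂^ m) 0ℓ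

generatedBy : ∀ {k m} → Matrix k m → Code m
generatedBy rows c = ∃ λ a → linearCombination a rows ≡ c

-- Subset k is, by definition, Vec Bool k = 𝔽₂^ k, so anySubset? searches
-- through all coefficient vectors.
generatedBy? : ∀ {k m} (rows : Matrix k m) → Decidable (generatedBy rows)
generatedBy? rows c = anySubset? λ a → linearCombination a rows ≟ᵛ c

supp : ∀ {m} → 𝔽₂^ m → Subset m
supp = map λ x → does (¬? (x Bool.≟ 0₂))

Minimal : ∀ {m} → Code m → Pred (𝔽₂^ m) 0ℓ
Minimal C c = C c × c ≢ 0ᵛ × ¬ (∃ λ c′ → C c′ × c′ ≢ 0ᵛ × supp c′ ⊂ supp c)

minimal? : ∀ {m} {C : Code m} → Decidable C → Decidable (Minimal C)
minimal? C? c =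
  C? c ×-dec ¬? (c ≟ᵛ 0ᵛ) ×-dec
  ¬? (anySubset? λ c′ → C? c′ ×-dec ¬? (c′ ≟ᵛ 0ᵛ) ×-dec (supp c′ ⊂? supp c))

-- Every element of 𝔽₂^ m, each listed exactly once.
allVectors : ∀ m → List (𝔽₂^ m)
allVectors zero    = [ [] ]
allVectors (suc m) = cartesianProductWith _∷_ (0₂ ∷ 1₂ ∷ []) (allVectors m)

numberOf : ∀ {m} {P : Pred (𝔽₂^ m) 0ℓ} → Decidable P → ℕ
numberOf {m} P? = length (filter P? (allVectors m))

record Graph (n : ℕ) : Set₁ where
  field
    _~_      : Rel (Fin n) 0ℓ
    _~?_     : Decidable₂ _~_
    ~-sym    : Symmetric _~_
    ~-irrefl : ∀ {i} → ¬ (i ~ i)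

adjacencyMatrix : ∀ {n} → Graph n → Matrix n n
adjacencyMatrix G = tabulate λ i → tabulate λ j → if does (i ~? j) then 1₂ else 0₂
  where open Graph G

generatorMatrix : ∀ {n} → Graph n → Matrix n (n + n)
generatorMatrix {n} G = identity n ∣∣ adjacencyMatrix G

codeOf : ∀ {n} → Graph n → Code (n + n)
codeOf G = generatedBy (generatorMatrix G)

codeOf? : ∀ {n} (G : Graph n) → Decidable (codeOf G)
codeOf? G = generatedBy? (generatorMatrix G)

M : ∀ {n} → Graph n → ℕ
M G = numberOf {P = Minimal (codeOf G)} (minimal? (codeOf? G))

-- The element i of Fin n stands for the vertex 1 + toℕ i.  The two summands are
-- the edges {v , v + 1} and {1 , n}, listed with the smaller endpoint first.
CycleEdge : ∀ n → Rel (Fin n) 0ℓ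
CycleEdge n i j = toℕ j ≡ suc (toℕ i) ⊎ (toℕ i ≡ 0 × suc (toℕ j) ≡ n)

cycleEdge? : ∀ n → Decidable₂ (CycleEdge n)
cycleEdge? n i j =
  (toℕ j ℕ.≟ suc (toℕ i)) ⊎-dec ((toℕ i ℕ.≟ 0) ×-dec (suc (toℕ j) ℕ.≟ n))

cycleEdge-irrefl : ∀ {n} → 3 ≤ n → ∀ {i} → ¬ CycleEdge n i i
cycleEdge-irrefl _   (inj₁ i≡1+i) = ℕ.1+n≢n (sym i≡1+i)
cycleEdge-irrefl 3≤n (inj₂ (i≡0 , 1+i≡n))
  rewrite i≡0 with refl ← 1+i≡n with s≤s () ← 3≤n

cycle : ∀ n → 3 ≤ n → Graph n
cycle n 3≤n = record
  { _~_      = λ i j → CycleEdge n i j ⊎ CycleEdge n j i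
  ; _~?_     = λ i j → cycleEdge? n i j ⊎-dec cycleEdge? n j i
  ; ~-sym    = swap
  ; ~-irrefl = λ { (inj₁ e) → cycleEdge-irrefl 3≤n e ; (inj₂ e) → cycleEdge-irrefl 3≤n e }
  }

{-# OPTIONS --safe #-}
module Submission where

-- Over the two-element field, the codeword generated by a set S of vertices of the cycle is
-- (S , b), where b at the vertex after j is S(j) + S(σ j), and σ moves every vertex two steps
-- forward. Hence the codeword of T has its support inside that of S exactly when T is a subset
-- of S and T changes between j and σ j only where S does. So the codeword of S is minimal iff
-- S is nonempty and no other nonempty subset of S has this property: S is indecomposable
-- (cw-minimal⇔).
--
-- The permutation σ splits the vertices into orbits of a common size p, namely one orbit with
-- p = n when n is odd, and two orbits with p = n / 2 when n is even. An indecomposable set is a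
-- connected piece of one orbit, that is, an arc s, σ s, σ² s, … with at least 1 and at most p
-- points. Indeed, if S is an arc, it does not change from one of its points to the next, so
-- neither does T, and T is all of S as soon as it is nonempty (arc-indecomposable). Conversely,
-- every nonempty S contains an entire orbit or a maximal run of consecutive points of an orbit,
-- and neither of these changes where S does not (indecomposable⇒arc).
--
-- An arc with fewer than p points determines its start and its length (start-unique and
-- length-unique), which gives n (p - 1) arcs; there remain the full orbits, one or two of them.
-- So the count is 1 + n (n - 1) for odd n and 2 + n (n / 2 - 1) for even n.

open import Algebra.Bundles using (CommutativeRing)
open import Data.Bool using (if_then_else_; _∧_; _xor_; not)
import Data.Bool.Properties as Bool
open import Data.Fin using (Fin; zero; suc; toℕ; fromℕ<; splitAt; _↑ˡ_; _↑ʳ_)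
import Data.Fin.Properties as Fin
open import Data.Fin.Subset using (_⊂_)
open import Data.List as List using (List; []; _∷_; length; cartesianProductWith; allFin)
import Data.List.Membership.Propositional as List
open import Data.List.Membership.Propositional.Properties
  using ( ∈-allFin; ∈-cartesianProductWith⁺; ∈-cartesianProductWith⁻; ∈-filter⁺; ∈-filter⁻
        ; ∈-map⁺; ∈-map⁻; ∈-++⁺ˡ; ∈-++⁺ʳ; ∈-++⁻ )
open import Data.List.Membership.Propositional.Properties.WithK using (unique∧set⇒bag)
import Data.List.Properties as List
open import Data.List.Relation.Binary.BagAndSetEquality using (∼bag⇒↭)
open import Data.List.Relation.Binary.Disjoint.Propositional using (Disjoint)
open import Data.List.Relation.Binary.Permutation.Propositional.Properties using (↭-length)
open import Data.List.Relation.Unary.All using ([]; _∷_)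
open import Data.List.Relation.Unary.AllPairs as AllPairs using (AllPairs; []; _∷_)
import Data.List.Relation.Unary.AllPairs.Properties as AllPairs
open import Data.List.Relation.Unary.Any using (here; there)
open import Data.List.Relation.Unary.Unique.Propositional using (Unique)
import Data.List.Relation.Unary.Unique.Propositional.Properties as Unique
open import Data.Nat
  using ( ℕ; zero; suc; pred; _+_; _*_; _∸_; _^_; _≤_; _<_; z≤n; s≤s; s≤s⁻¹; z<s
        ; NonZero; >-nonZero )
open import Data.Nat.DivMod
  using ( _/_; _%_; _mod_; m%n<n; m%n%n≡m%n; m<n⇒m%n≡m; m≡m%n+[m/n]*n; m*n%n≡0; m*n/n≡m; n%n≡0
        ; %-distribˡ-+; [m+kn]%n≡m%n; m∣n⇒o%n%m≡o%m )
open import Data.Nat.Divisibility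
  using (_∣_; divides; ∣-refl; >⇒∤; *-cancelʳ-∣; m%n≡0⇒n∣m; n∣m⇒m%n≡0)
open import Data.Nat.GeneralisedArithmetic using (fold; fold-+)
open import Data.Nat.Primality using (euclidsLemma; prime[2])
import Data.Nat.Properties as ℕ
open import Data.Nat.Tactic.RingSolver using (solve-∀)
open import Data.Product using (∃; ∃₂; _×_; _,_; proj₂)
open import Data.Sum using (_⊎_; inj₁; inj₂; [_,_]′; swap)
open import Data.Vec as Vec using ([]; _∷_; lookup; tabulate)
import Data.Vec.Properties as Vec
open import Defs
open import Function using (_∘_; id; _⇔_; mk⇔; Equivalence)
open import Level using (0ℓ)
open import Relation.Binary.Definitions using (tri<; tri≈; tri>)
open import Relation.Binary.PropositionalEquality
  using (_≡_; _≢_; refl; sym; trans; cong; cong₂; subst; subst₂; module ≡-Reasoning)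
open import Relation.Nullary using (¬_; Dec; yes; no; does; contradiction)
open import Relation.Nullary.Decidable using (dec-true; dec-false)
open import Relation.Unary using (Pred; Decidable)
open import Algebra.Properties.CommutativeMonoid.Sum
  (CommutativeRing.+-commutativeMonoid Bool.xor-∧-commutativeRing)
  using (sum; sum-cong-≗; ∑-distrib-+; sum-replicate-zero)

-- Counting by enumeration

allVectors-unique : ∀ m → Unique (allVectors m)
allVectors-unique zero    = [] ∷ []
allVectors-unique (suc m) =
  Unique.cartesianProductWith⁺ _∷_ Vec.∷-injective
    (((λ ()) ∷ []) ∷ [] ∷ []) (allVectors-unique m)

∈-allVectors : ∀ {m} (v : 𝔽₂^ m) → v List.∈ allVectors m
∈-allVectors []      = here refl
∈-allVectors (x ∷ v) = ∈-cartesianProductWith⁺ _∷_ (∈-bits x) (∈-allVectors v)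
  where
  ∈-bits : ∀ x → x List.∈ (0₂ ∷ 1₂ ∷ [])
  ∈-bits 0₂ = here refl
  ∈-bits 1₂ = there (here refl)

-- A number of vectors is the length of any duplicate-free list of exactly those vectors.
numberOf-enumeration : ∀ {m} {P : Pred (𝔽₂^ m) 0ℓ} (P? : Decidable P) {L : List (𝔽₂^ m)} →
  Unique L → (∀ {v} → v List.∈ L ⇔ P v) → numberOf P? ≡ length L
numberOf-enumeration {m} P? {L} unique L⇔P =
  ↭-length (∼bag⇒↭ (unique∧set⇒bag (Unique.filter⁺ P? (allVectors-unique m)) unique
    (mk⇔ (λ v∈ → from L⇔P (proj₂ (∈-filter⁻ P? {xs = allVectors m} v∈)))
         (λ v∈ → ∈-filter⁺ P? (∈-allVectors _) (to L⇔P v∈)))))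
  where open Equivalence

length-cartesianProductWith : ∀ {A B C : Set} (f : A → B → C) xs ys →
  length (cartesianProductWith f xs ys) ≡ length xs * length ys
length-cartesianProductWith f []       ys = refl
length-cartesianProductWith f (x ∷ xs) ys = begin
  length (List.map (f x) ys List.++ cartesianProductWith f xs ys)
    ≡⟨ List.length-++ (List.map (f x) ys) ⟩
  length (List.map (f x) ys) + length (cartesianProductWith f xs ys)
    ≡⟨ cong₂ _+_ (List.length-map (f x) ys) (length-cartesianProductWith f xs ys) ⟩
  length ys + length xs * length ys ∎
  where open ≡-Reasoning

-- Vectors over the two-element field as subsets

infix 4 _∋_ _⊑_

-- Position i lies in the support of v.
_∋_ : ∀ {m} → 𝔽₂^ m → Fin m → Set
v ∋ i = lookup v i ≡ 1₂

-- Inclusion of supports.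
_⊑_ : ∀ {m} → 𝔽₂^ m → 𝔽₂^ m → Set
v ⊑ w = ∀ i → v ∋ i → w ∋ i

lookup-injective : ∀ {m} {v w : 𝔽₂^ m} → (∀ i → lookup v i ≡ lookup w i) → v ≡ w
lookup-injective {v = v} {w} eq = begin
  v                   ≡⟨ Vec.tabulate∘lookup v ⟨
  tabulate (lookup v) ≡⟨ Vec.tabulate-cong eq ⟩
  tabulate (lookup w) ≡⟨ Vec.tabulate∘lookup w ⟩
  w                   ∎
  where open ≡-Reasoning

⊑-antisym : ∀ {m} {v w : 𝔽₂^ m} → v ⊑ w → w ⊑ v → v ≡ w
⊑-antisym {v = v} {w} v⊑w w⊑v = lookup-injective λ i → bits (v⊑w i) (w⊑v i)
  where
  bits : ∀ {a b} → (a ≡ 1₂ → b ≡ 1₂) → (b ≡ 1₂ → a ≡ 1₂) → a ≡ b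
  bits {0₂} {0₂} f g = refl
  bits {0₂} {1₂} f g = g refl
  bits {1₂} {b}  f g = sym (f refl)

≢0ᵛ⇒∋ : ∀ {m} {v : 𝔽₂^ m} → v ≢ 0ᵛ → ∃ (v ∋_)
≢0ᵛ⇒∋ {v = v} v≢0 with Fin.any? (λ i → lookup v i Bool.≟ 1₂)
... | yes v∋ = v∋
... | no ¬v∋ = contradiction
  (⊑-antisym (λ i v∋i → contradiction (i , v∋i) ¬v∋)
             (λ i 0∋i → contradiction (trans (sym 0∋i) (Vec.lookup-replicate i 0₂)) λ ()))
  v≢0

∋⇒≢0ᵛ : ∀ {m} {v : 𝔽₂^ m} {i} → v ∋ i → v ≢ 0ᵛ
∋⇒≢0ᵛ {i = i} v∋i refl with () ← trans (sym v∋i) (Vec.lookup-replicate i 0₂)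

supp-id : ∀ {m} (v : 𝔽₂^ m) → supp v ≡ v
supp-id []       = refl
supp-id (0₂ ∷ v) = cong (0₂ ∷_) (supp-id v)
supp-id (1₂ ∷ v) = cong (1₂ ∷_) (supp-id v)

supp-⊂⇔ : ∀ {m} {v w : 𝔽₂^ m} →
  supp v ⊂ supp w ⇔ (v ⊑ w × ∃ λ i → w ∋ i × ¬ v ∋ i)
supp-⊂⇔ {v = v} {w} rewrite supp-id v | supp-id w = mk⇔
  (λ (v⊆w , i , i∈w , i∉v) →
    (λ j → Vec.[]=⇒lookup ∘ v⊆w ∘ Vec.lookup⇒[]= j v) ,
    i , Vec.[]=⇒lookup i∈w , i∉v ∘ Vec.lookup⇒[]= i v)
  (λ (v⊑w , i , w∋i , ¬v∋i) →
    (λ {j} → Vec.lookup⇒[]= j w ∘ v⊑w j ∘ Vec.[]=⇒lookup) ,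
    i , Vec.lookup⇒[]= i w w∋i , ¬v∋i ∘ Vec.[]=⇒lookup)

-- Linear combinations of rows

lookup-linearCombination : ∀ {k m} (a : 𝔽₂^ k) (rows : Matrix k m) j →
  lookup (linearCombination a rows) j ≡ sum (λ i → lookup a i ∧ lookup (lookup rows i) j)
lookup-linearCombination []      []           j = Vec.lookup-replicate j 0₂
lookup-linearCombination (x ∷ a) (row ∷ rows) j =
  trans (Vec.lookup-zipWith _xor_ j (x ·ᵛ row) _)
        (cong₂ _xor_ (Vec.lookup-map j (x ∧_) row) (lookup-linearCombination a rows j))

-- Here and below, sums are taken in the two-element field.
sum-indicator : ∀ {n} (f : Fin n → 𝔽₂) u → sum (λ i → f i ∧ does (i Fin.≟ u)) ≡ f u
sum-indicator {suc n} f zero = begin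
  (f zero ∧ 1₂) xor sum (λ i → f (suc i) ∧ 0₂)
    ≡⟨ cong₂ _xor_ (Bool.∧-identityʳ (f zero))
         (trans (sum-cong-≗ λ i → Bool.∧-zeroʳ (f (suc i))) (sum-replicate-zero n)) ⟩
  f zero xor 0₂ ≡⟨ Bool.xor-identityʳ (f zero) ⟩
  f zero        ∎
  where open ≡-Reasoning
sum-indicator f (suc u) =
  cong₂ _xor_ (Bool.∧-zeroʳ (f zero)) (sum-indicator (f ∘ suc) u)

if-1₂-else-0₂ : ∀ b → (if b then 1₂ else 0₂) ≡ b
if-1₂-else-0₂ 0₂ = refl
if-1₂-else-0₂ 1₂ = refl

-- The code of a graph

module _ {n} (G : Graph n) where
  open Graph G

  -- The codeword (a , A a) with coefficient vector a.
  codeword : 𝔽₂^ n → 𝔽₂^ (n + n)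
  codeword a = linearCombination a (generatorMatrix G)

  lookup-codeword-↑ˡ : ∀ a i → lookup (codeword a) (i ↑ˡ n) ≡ lookup a i
  lookup-codeword-↑ˡ a i = begin
    lookup (codeword a) (i ↑ˡ n)
      ≡⟨ lookup-linearCombination a (generatorMatrix G) (i ↑ˡ n) ⟩
    sum (λ k → lookup a k ∧ lookup (lookup (generatorMatrix G) k) (i ↑ˡ n))
      ≡⟨ sum-cong-≗ (λ k → cong (lookup a k ∧_) (entry k)) ⟩
    sum (λ k → lookup a k ∧ does (k Fin.≟ i))
      ≡⟨ sum-indicator (lookup a) i ⟩
    lookup a i ∎
    where
    open ≡-Reasoning
    entry : ∀ k → lookup (lookup (generatorMatrix G) k) (i ↑ˡ n) ≡ does (k Fin.≟ i)
    entry k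
      rewrite Vec.lookup-zipWith Vec._++_ k (identity n) (adjacencyMatrix G)
            | Vec.lookup-++ˡ (lookup (identity n) k) (lookup (adjacencyMatrix G) k) i
            | Vec.lookup∘tabulate (λ k → tabulate λ j → if does (k Fin.≟ j) then 1₂ else 0₂) k
            | Vec.lookup∘tabulate (λ j → if does (k Fin.≟ j) then 1₂ else 0₂) i
      = if-1₂-else-0₂ _

  lookup-codeword-↑ʳ : ∀ a i →
    lookup (codeword a) (n ↑ʳ i) ≡ sum (λ k → lookup a k ∧ does (k ~? i))
  lookup-codeword-↑ʳ a i =
    trans (lookup-linearCombination a (generatorMatrix G) (n ↑ʳ i))
          (sum-cong-≗ (λ k → cong (lookup a k ∧_) (entry k)))
    where
    entry : ∀ k → lookup (lookup (generatorMatrix G) k) (n ↑ʳ i) ≡ does (k ~? i)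
    entry k
      rewrite Vec.lookup-zipWith Vec._++_ k (identity n) (adjacencyMatrix G)
            | Vec.lookup-++ʳ (lookup (identity n) k) (lookup (adjacencyMatrix G) k) i
            | Vec.lookup∘tabulate (λ k → tabulate λ j → if does (k ~? j) then 1₂ else 0₂) k
            | Vec.lookup∘tabulate (λ j → if does (k ~? j) then 1₂ else 0₂) i
      = if-1₂-else-0₂ _

  codeword-injective : ∀ {a b} → codeword a ≡ codeword b → a ≡ b
  codeword-injective {a} {b} eq = lookup-injective λ i → begin
    lookup a i                   ≡⟨ lookup-codeword-↑ˡ a i ⟨
    lookup (codeword a) (i ↑ˡ n) ≡⟨ cong (λ c → lookup c (i ↑ˡ n)) eq ⟩
    lookup (codeword b) (i ↑ˡ n) ≡⟨ lookup-codeword-↑ˡ b i ⟩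
    lookup b i                   ∎
    where open ≡-Reasoning

  -- In the adjacency block, a vertex i whose neighbours are exactly the two vertices u and w
  -- carries the entry a(u) + a(w).
  lookup-codeword-deg2 : ∀ {i u w} → u ≢ w → (∀ k → k ~ i ⇔ (k ≡ u ⊎ k ≡ w)) →
    ∀ a → lookup (codeword a) (n ↑ʳ i) ≡ lookup a u xor lookup a w
  lookup-codeword-deg2 {i} {u} {w} u≢w nbr a = begin
    lookup (codeword a) (n ↑ʳ i)
      ≡⟨ lookup-codeword-↑ʳ a i ⟩
    sum (λ k → lookup a k ∧ does (k ~? i))
      ≡⟨ sum-cong-≗ (λ k → trans (cong (lookup a k ∧_) (split k))
           (Bool.∧-distribˡ-xor (lookup a k) _ _)) ⟩
    sum (λ k → (lookup a k ∧ does (k Fin.≟ u)) xor (lookup a k ∧ does (k Fin.≟ w)))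
      ≡⟨ ∑-distrib-+ (λ k → lookup a k ∧ does (k Fin.≟ u)) _ ⟩
    sum (λ k → lookup a k ∧ does (k Fin.≟ u)) xor sum (λ k → lookup a k ∧ does (k Fin.≟ w))
      ≡⟨ cong₂ _xor_ (sum-indicator (lookup a) u) (sum-indicator (lookup a) w) ⟩
    lookup a u xor lookup a w ∎
    where
    open ≡-Reasoning
    open Equivalence
    split : ∀ k → does (k ~? i) ≡ does (k Fin.≟ u) xor does (k Fin.≟ w)
    split k with k Fin.≟ u | k Fin.≟ w
    ... | yes k≡u | yes k≡w = contradiction (trans (sym k≡u) k≡w) u≢w
    ... | yes k≡u | no  _   = dec-true  (k ~? i) (from (nbr k) (inj₁ k≡u))
    ... | no  _   | yes k≡w = dec-true  (k ~? i) (from (nbr k) (inj₂ k≡w))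
    ... | no  k≢u | no  k≢w = dec-false (k ~? i) ([ k≢u , k≢w ]′ ∘ to (nbr k))

-- Indecomposable subsets of a permuted set are arcs

-- T changes between j and σ j only where S does.
Coarser : ∀ {n} → (Fin n → Fin n) → 𝔽₂^ n → 𝔽₂^ n → Set
Coarser σ T S = ∀ j → lookup S j ≡ lookup S (σ j) → lookup T j ≡ lookup T (σ j)

-- A nonempty set S with no nonempty proper subset that is coarser than S. Seen as connectivity:
-- in the graph with an edge from each j to σ j, a coarser set cuts only edges that S cuts, so the
-- coarser subsets of S are the unions of connected components of S.
Indecomposable : ∀ {n} → (Fin n → Fin n) → 𝔽₂^ n → Set
Indecomposable σ S =
  ∃ (S ∋_) × (∀ T → ∃ (T ∋_) → T ⊑ S → Coarser σ T S → T ≡ S)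

-- Either f is constantly b below m, or there is a first argument below m where it is not.
prefix : ∀ (f : ℕ → 𝔽₂) b m →
  (∀ {k} → k < m → f k ≡ b) ⊎ (∃ λ ℓ → ℓ < m × (∀ {k} → k < ℓ → f k ≡ b) × f ℓ ≡ not b)
prefix f b zero = inj₁ λ ()
prefix f b (suc m) with prefix f b m
... | inj₂ (ℓ , ℓ<m , before , at) = inj₂ (ℓ , ℕ.m<n⇒m<1+n ℓ<m , before , at)
... | inj₁ before with f m Bool.≟ b
...   | no  fm≢b = inj₂ (m , ℕ.≤-refl , before , Bool.¬-not fm≢b)
...   | yes fm≡b = inj₁ upto
  where
  upto : ∀ {k} → k < suc m → f k ≡ b
  upto k<1+m with ℕ.m≤n⇒m<n∨m≡n (s≤s⁻¹ k<1+m)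
  ... | inj₁ k<m  = before k<m
  ... | inj₂ refl = fm≡b

module Arcs {n} (σ : Fin n → Fin n) where

  infixl 8 _^∙_

  -- The point σ^k s.
  _^∙_ : Fin n → ℕ → Fin n
  s ^∙ k = fold s σ k

  ^∙-suc : ∀ s k → σ s ^∙ k ≡ s ^∙ suc k
  ^∙-suc s zero    = refl
  ^∙-suc s (suc k) = cong σ (^∙-suc s k)

  onArc? : ∀ s ℓ j → Dec (∃ λ k → k < ℓ × s ^∙ k ≡ j)
  onArc? s ℓ j = ℕ.anyUpTo? (λ k → (s ^∙ k) Fin.≟ j) ℓ

  opaque
    -- The arc consisting of s, σ s, …, σ^(ℓ - 1) s. It is opaque so that s and ℓ can be inferred
    -- from it; the lemmas arc∋⁺ and arc∋⁻ characterise its points.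
    arc : Fin n → ℕ → 𝔽₂^ n
    arc s ℓ = tabulate λ j → does (onArc? s ℓ j)

    arc∋⁺ : ∀ s {ℓ k} → k < ℓ → arc s ℓ ∋ s ^∙ k
    arc∋⁺ s {ℓ} {k} k<ℓ =
      trans (Vec.lookup∘tabulate _ (s ^∙ k)) (dec-true (onArc? s ℓ _) (k , k<ℓ , refl))

    arc∋⁻ : ∀ s {ℓ j} → arc s ℓ ∋ j → ∃ λ k → k < ℓ × s ^∙ k ≡ j
    arc∋⁻ s {ℓ} {j} ∋j with onArc? s ℓ j | trans (sym (Vec.lookup∘tabulate _ j)) ∋j
    ... | yes on | _ = on

  arc⊑ : ∀ s {ℓ} (S : 𝔽₂^ n) → (∀ {k} → k < ℓ → S ∋ s ^∙ k) → arc s ℓ ⊑ S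
  arc⊑ s S on j ∋j with k , k<ℓ , refl ← arc∋⁻ s ∋j = on k<ℓ

  arc-indecomposable : ∀ s {ℓ} → 0 < ℓ → Indecomposable σ (arc s ℓ)
  arc-indecomposable s {ℓ} 0<ℓ = (s , arc∋⁺ s 0<ℓ) , minimal
    where
    minimal : ∀ T → ∃ (T ∋_) → T ⊑ arc s ℓ → Coarser σ T (arc s ℓ) → T ≡ arc s ℓ
    minimal T (j , T∋j) T⊑ coarser = ⊑-antisym T⊑ (arc⊑ s T λ k<ℓ → trans (constant k<ℓ) T∋s)
      where
      constant : ∀ {k} → k < ℓ → lookup T (s ^∙ k) ≡ lookup T s
      constant {zero}  _     = refl
      constant {suc k} 1+k<ℓ = trans
        (sym (coarser (s ^∙ k) (trans (arc∋⁺ s (ℕ.<⇒≤ 1+k<ℓ)) (sym (arc∋⁺ s 1+k<ℓ)))))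
        (constant (ℕ.<⇒≤ 1+k<ℓ))
      T∋s : T ∋ s
      T∋s with k , k<ℓ , refl ← arc∋⁻ s (T⊑ j T∋j) = trans (sym (constant k<ℓ)) T∋j

-- All orbits of σ have the same size suc q, written as a successor because the proper arcs are
-- those with at most q points. The inverse of σ is then σ^q.
module FreeOrbits {n} (σ : Fin n → Fin n) (q : ℕ)
  (period : ∀ i → fold i σ (suc q) ≡ i)
  (free   : ∀ i {k} → 0 < k → k ≤ q → fold i σ k ≢ i)
  where

  open Arcs σ

  pred-σ : ∀ {i j} → σ i ≡ j → i ≡ j ^∙ q
  pred-σ {i} refl = trans (sym (period i)) (sym (^∙-suc i q))

  σ-injective : ∀ {i j} → σ i ≡ σ j → i ≡ j
  σ-injective eq = trans (pred-σ eq) (sym (pred-σ refl))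

  ^∙-≢ : ∀ s {a b} → a < b → b ≤ q → s ^∙ a ≢ s ^∙ b
  ^∙-≢ s {a} {b} a<b b≤q eq = free (s ^∙ a) (ℕ.m<n⇒0<n∸m a<b) (ℕ.≤-trans (ℕ.m∸n≤m b a) b≤q)
    (begin
      s ^∙ a ^∙ (b ∸ a)   ≡⟨ fold-+ s σ (b ∸ a) {a} ⟨
      s ^∙ (b ∸ a + a)    ≡⟨ cong (s ^∙_) (ℕ.m∸n+n≡m (ℕ.<⇒≤ a<b)) ⟩
      s ^∙ b              ≡⟨ eq ⟨
      s ^∙ a              ∎)
    where open ≡-Reasoning

  end∉arc : ∀ s {ℓ m} → ℓ ≤ m → m ≤ q → ¬ arc s ℓ ∋ s ^∙ m
  end∉arc s ℓ≤m m≤q ∋m with k , k<ℓ , eq ← arc∋⁻ s ∋m = ^∙-≢ s (ℕ.<-≤-trans k<ℓ ℓ≤m) m≤q eq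

  -- A proper arc has only one point whose predecessor lies outside the arc, namely its start; the
  -- predecessor of s is σ^q s.
  start-unique : ∀ {s s′ ℓ ℓ′} → 0 < ℓ → ℓ ≤ q → arc s ℓ ≡ arc s′ ℓ′ → s ≡ s′
  start-unique {s} {s′} {ℓ} {ℓ′} 0<ℓ ℓ≤q eq
    with arc∋⁻ s′ (subst (_∋ s) eq (arc∋⁺ s 0<ℓ))
  ... | zero  , _      , s′≡s = sym s′≡s
  ... | suc k , 1+k<ℓ′ , σk≡s = contradiction
    (subst₂ _∋_ (sym eq) (pred-σ σk≡s) (arc∋⁺ s′ (ℕ.<⇒≤ 1+k<ℓ′)))
    (end∉arc s ℓ≤q ℕ.≤-refl)

  length-unique : ∀ {s ℓ ℓ′} → ℓ ≤ q → ℓ′ ≤ q → arc s ℓ ≡ arc s ℓ′ → ℓ ≡ ℓ′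
  length-unique {s} {ℓ} {ℓ′} ℓ≤q ℓ′≤q eq with ℕ.<-cmp ℓ ℓ′
  ... | tri≈ _ ℓ≡ℓ′ _ = ℓ≡ℓ′
  ... | tri< ℓ<ℓ′ _ _ = contradiction
    (subst (_∋ s ^∙ ℓ) (sym eq) (arc∋⁺ s ℓ<ℓ′)) (end∉arc s ℕ.≤-refl ℓ≤q)
  ... | tri> _ _ ℓ′<ℓ = contradiction
    (subst (_∋ s ^∙ ℓ′) eq (arc∋⁺ s ℓ′<ℓ)) (end∉arc s ℕ.≤-refl ℓ′≤q)

  -- The full orbit of s.
  orbit : Fin n → 𝔽₂^ n
  orbit s = arc s (suc q)

  orbit∋⁺ : ∀ s k → orbit s ∋ s ^∙ k
  orbit∋⁺ s zero    = arc∋⁺ s z<s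
  orbit∋⁺ s (suc k) with i , i<1+q , eq ← arc∋⁻ s (orbit∋⁺ s k) | ℕ.m≤n⇒m<n∨m≡n (s≤s⁻¹ i<1+q)
  ... | inj₁ i<q  = subst (λ x → orbit s ∋ σ x) eq (arc∋⁺ s (s≤s i<q))
  ... | inj₂ refl = subst (orbit s ∋_) (trans (sym (period s)) (cong σ eq)) (arc∋⁺ s z<s)

  orbit⊑ : ∀ {s t} → orbit s ∋ t → orbit t ⊑ orbit s
  orbit⊑ {s} {t} ∋t with k , _ , refl ← arc∋⁻ s ∋t = arc⊑ t (orbit s) λ {i} _ →
    subst (orbit s ∋_) (fold-+ s σ i) (orbit∋⁺ s (i + k))

  orbit-σ : ∀ s j → lookup (orbit s) j ≡ lookup (orbit s) (σ j)
  orbit-σ s j with lookup (orbit s) j in at-j | lookup (orbit s) (σ j) in at-σj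
  ... | 0₂ | 0₂ = refl
  ... | 1₂ | 1₂ = refl
  ... | 1₂ | 0₂ with k , _ , refl ← arc∋⁻ s at-j =
    trans (sym (orbit∋⁺ s (suc k))) at-σj
  ... | 0₂ | 1₂ with k , _ , eq ← arc∋⁻ s at-σj = trans (sym at-j)
    (subst (orbit s ∋_)
      (trans (fold-+ s σ q) (trans (cong (_^∙ q) eq) (sym (pred-σ refl))))
      (orbit∋⁺ s (q + k)))

  orbit-≡ : ∀ {s t} → orbit s ∋ t → orbit t ≡ orbit s
  orbit-≡ {s} {t} ∋t = proj₂ (arc-indecomposable s z<s) (orbit t) (t , orbit∋⁺ t 0)
    (orbit⊑ ∋t) (λ j _ → orbit-σ t j)

  orbit≢arc : ∀ {r s ℓ} → 0 < ℓ → ℓ ≤ q → orbit r ≢ arc s ℓ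
  orbit≢arc {r} {s} {ℓ} 0<ℓ ℓ≤q eq = end∉arc s {ℓ} ℕ.≤-refl ℓ≤q
    (subst (_∋ s ^∙ ℓ) eq
      (orbit⊑ (subst (_∋ s) (sym eq) (arc∋⁺ s 0<ℓ)) (s ^∙ ℓ) (orbit∋⁺ s ℓ)))

  -- A maximal run of S from s on, with both neighbouring points outside S, is coarser than S.
  arc-coarser : ∀ s ℓ (S : 𝔽₂^ n) → S ∋ s → (∀ {k} → k < ℓ → S ∋ s ^∙ k) →
    lookup S (s ^∙ ℓ) ≡ 0₂ → lookup S (s ^∙ q) ≡ 0₂ → Coarser σ (arc s ℓ) S
  arc-coarser s ℓ S S∋s on after before j same
    with lookup (arc s ℓ) j in at-j | lookup (arc s ℓ) (σ j) in at-σj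
  ... | 0₂ | 0₂ = refl
  ... | 1₂ | 1₂ = refl
  ... | 1₂ | 0₂ with k , k<ℓ , refl ← arc∋⁻ s {ℓ} at-j with ℕ.m≤n⇒m<n∨m≡n k<ℓ
  ...   | inj₁ 1+k<ℓ = trans (sym (arc∋⁺ s 1+k<ℓ)) at-σj
  ...   | inj₂ refl  = trans (sym (on k<ℓ)) (trans same after)
  arc-coarser s ℓ S S∋s on after before j same
      | 0₂ | 1₂ with arc∋⁻ s at-σj
  ... | zero  , _     , s≡σj =
    trans (sym before) (trans (cong (lookup S) (sym (pred-σ (sym s≡σj))))
      (trans same (trans (cong (lookup S) (sym s≡σj)) S∋s)))
  ... | suc k , 1+k<ℓ , eq   =
    trans (sym at-j) (subst (arc s ℓ ∋_) (σ-injective eq) (arc∋⁺ s (ℕ.<⇒≤ 1+k<ℓ)))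

  indecomposable⇒arc : ∀ {S} → Indecomposable σ S →
    (∃ λ t → S ≡ orbit t) ⊎ (∃₂ λ s ℓ → 0 < ℓ × ℓ ≤ q × S ≡ arc s ℓ)
  indecomposable⇒arc {S} ((t , S∋t) , minimal) with prefix (λ k → lookup S (t ^∙ k)) 1₂ (suc q)
  ... | inj₁ on = inj₁ (t ,
    sym (minimal (orbit t) (t , orbit∋⁺ t 0) (arc⊑ t S on) (λ j _ → orbit-σ t j)))
  ... | inj₂ (a , a<1+q , _ , off)
    with prefix (λ k → lookup S (t ^∙ a ^∙ k)) 0₂ (suc (suc q))
  -- Going on from σ^a t, which is outside S, the orbit returns to t, which is in S. One step past
  -- a full round is searched, because the return takes suc q steps when a is 0.
  ...   | inj₁ empty = contradiction (trans (sym S∋t) S∌t) λ ()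
    where
    back : t ^∙ a ^∙ (suc q ∸ a) ≡ t
    back = trans (sym (fold-+ t σ (suc q ∸ a)))
      (trans (cong (t ^∙_) (ℕ.m∸n+n≡m (ℕ.<⇒≤ a<1+q))) (period t))
    S∌t : lookup S t ≡ 0₂
    S∌t = trans (cong (lookup S) (sym back)) (empty (s≤s (ℕ.m∸n≤m (suc q) a)))
  ...   | inj₂ (zero , _ , _ , on) = contradiction (trans (sym on) off) λ ()
  ...   | inj₂ (suc b , _ , empty , S∋s) = proper
    where
    -- The first point of S met after σ^a t, hence the start of a run of S.
    s = t ^∙ a ^∙ suc b
    before : lookup S (s ^∙ q) ≡ 0₂
    before = trans (cong (lookup S) (sym (pred-σ refl))) (empty ℕ.≤-refl)
    proper : _
    proper with prefix (λ k → lookup S (s ^∙ k)) 1₂ (suc q)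
    ... | inj₁ on = contradiction (trans (sym (on ℕ.≤-refl)) before) λ ()
    ... | inj₂ (zero , _ , _ , off) = contradiction (trans (sym S∋s) off) λ ()
    ... | inj₂ (ℓ@(suc _) , ℓ<1+q , on , after) = inj₂ (s , ℓ , z<s , s≤s⁻¹ ℓ<1+q ,
      sym (minimal (arc s ℓ) (s , arc∋⁺ s z<s) (arc⊑ s S on)
        (arc-coarser s ℓ S S∋s on after before)))

  -- All indecomposable sets, listed from one representative of each orbit.
  module Enumeration (reps : List (Fin n))
    (distinct : AllPairs (λ r r′ → ∀ k → r ^∙ k ≢ r′) reps)
    (covering : ∀ i → ∃ λ r → r List.∈ reps × ∃ λ k → r ^∙ k ≡ i)
    where

    orbits properArcs indecomposables : List (𝔽₂^ n)
    orbits          = List.map orbit reps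
    properArcs      = cartesianProductWith (λ s k → arc s (suc (toℕ k))) (allFin n) (allFin q)
    indecomposables = orbits List.++ properArcs

    length-indecomposables : length indecomposables ≡ length reps + n * q
    length-indecomposables = begin
      length (orbits List.++ properArcs)
        ≡⟨ List.length-++ orbits ⟩
      length orbits + length properArcs
        ≡⟨ cong₂ _+_ (List.length-map orbit reps)
             (length-cartesianProductWith _ (allFin n) (allFin q)) ⟩
      length reps + length (allFin n) * length (allFin q)
        ≡⟨ cong (length reps +_)
             (cong₂ _*_ (List.length-tabulate {n = n} id) (List.length-tabulate {n = q} id)) ⟩
      length reps + n * q ∎
      where open ≡-Reasoning

    indecomposables-unique : Unique indecomposables
    indecomposables-unique = Unique.++⁺
      (AllPairs.map⁺ (AllPairs.map orbit≢ distinct))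
      (Unique.cartesianProductWith⁺ _ arc-injective (Unique.allFin⁺ n) (Unique.allFin⁺ q))
      disjoint
      where
      orbit≢ : ∀ {r r′} → (∀ k → r ^∙ k ≢ r′) → orbit r ≢ orbit r′
      orbit≢ {r} {r′} apart eq
        with k , _ , rk≡r′ ← arc∋⁻ r (subst (_∋ r′) (sym eq) (orbit∋⁺ r′ 0)) = apart k rk≡r′
      arc-injective : ∀ {s s′} {k k′ : Fin q} →
        arc s (suc (toℕ k)) ≡ arc s′ (suc (toℕ k′)) → s ≡ s′ × k ≡ k′
      arc-injective {s} {s′} {k} {k′} eq
        with refl ← start-unique {s} {s′} {ℓ′ = suc (toℕ k′)} z<s (Fin.toℕ<n k) eq =
        refl , Fin.toℕ-injective (ℕ.suc-injective (length-unique {s} (Fin.toℕ<n k) (Fin.toℕ<n k′) eq))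
      disjoint : Disjoint orbits properArcs
      disjoint (∈orbits , ∈arcs) with r , _ , refl ← ∈-map⁻ orbit ∈orbits
        with s , k , _ , _ , eq ← ∈-cartesianProductWith⁻ _ (allFin n) (allFin q) ∈arcs =
        orbit≢arc {r} {s} z<s (Fin.toℕ<n k) eq

    ∈-indecomposables : ∀ {S} → S List.∈ indecomposables ⇔ Indecomposable σ S
    ∈-indecomposables {S} = mk⇔ sound complete
      where
      sound : S List.∈ indecomposables → Indecomposable σ S
      sound S∈ with ∈-++⁻ orbits S∈
      ... | inj₁ ∈orbits with r , _ , refl ← ∈-map⁻ orbit ∈orbits = arc-indecomposable r z<s
      ... | inj₂ ∈arcs
        with s , k , _ , _ , refl ← ∈-cartesianProductWith⁻ _ (allFin n) (allFin q) ∈arcs =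
        arc-indecomposable s z<s
      complete : Indecomposable σ S → S List.∈ indecomposables
      complete ind with indecomposable⇒arc ind
      ... | inj₁ (t , refl) with r , r∈reps , k , refl ← covering t =
        ∈-++⁺ˡ (subst (List._∈ orbits) (sym (orbit-≡ (orbit∋⁺ r k))) (∈-map⁺ orbit r∈reps))
      ... | inj₂ (s , suc ℓ , _ , ℓ<q , refl) = ∈-++⁺ʳ orbits
        (subst (λ m → arc s (suc m) List.∈ properArcs) (Fin.toℕ-fromℕ< ℓ<q)
          (∈-cartesianProductWith⁺ _ (∈-allFin s) (∈-allFin (fromℕ< ℓ<q))))

-- Minimal codewords of the cycle

module Cycle (n : ℕ) (3≤n : 3 ≤ n) where

  instance
    n-nonZero : NonZero n
    n-nonZero = >-nonZero (ℕ.≤-trans (s≤s z≤n) 3≤n)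

  G : Graph n
  G = cycle n 3≤n

  open Graph G

  -- The cyclic successor of a vertex.
  next : Fin n → Fin n
  next i = suc (toℕ i) mod n

  toℕ-mod : ∀ k → toℕ (k mod n) ≡ k % n
  toℕ-mod k = Fin.toℕ-fromℕ< (m%n<n k n)

  toℕ-next^ : ∀ i k → toℕ (fold i next k) ≡ (k + toℕ i) % n
  toℕ-next^ i zero    = sym (m<n⇒m%n≡m (Fin.toℕ<n i))
  toℕ-next^ i (suc k) = begin
    toℕ (next (fold i next k))       ≡⟨ toℕ-mod (suc (toℕ (fold i next k))) ⟩
    (1 + toℕ (fold i next k)) % n    ≡⟨ cong (λ x → (1 + x) % n) (toℕ-next^ i k) ⟩
    (1 + (k + toℕ i) % n) % n        ≡⟨ %-distribˡ-+ 1 _ n ⟩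
    (1 % n + (k + toℕ i) % n % n) % n ≡⟨ cong (λ x → (1 % n + x) % n) (m%n%n≡m%n (k + toℕ i) n) ⟩
    (1 % n + (k + toℕ i) % n) % n    ≡⟨ %-distribˡ-+ 1 (k + toℕ i) n ⟨
    (1 + (k + toℕ i)) % n            ∎
    where open ≡-Reasoning

  next^-≡ : ∀ i k → (k + toℕ i) % n ≡ toℕ i → fold i next k ≡ i
  next^-≡ i k eq = Fin.toℕ-injective (trans (toℕ-next^ i k) eq)

  next^-return : ∀ i k → fold i next k ≡ i → n ∣ k
  next^-return i k eq = divides ((k + toℕ i) / n) (ℕ.+-cancelʳ-≡ (toℕ i) k _ (begin
    k + toℕ i                                   ≡⟨ m≡m%n+[m/n]*n (k + toℕ i) n ⟩
    (k + toℕ i) % n + (k + toℕ i) / n * n       ≡⟨ cong (_+ (k + toℕ i) / n * n)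
                                                     (trans (sym (toℕ-next^ i k)) (cong toℕ eq)) ⟩
    toℕ i + (k + toℕ i) / n * n                 ≡⟨ ℕ.+-comm (toℕ i) _ ⟩
    (k + toℕ i) / n * n + toℕ i                 ∎))
    where open ≡-Reasoning

  next^-multiple : ∀ i c → fold i next (c * n) ≡ i
  next^-multiple i c = next^-≡ i (c * n) (begin
    (c * n + toℕ i) % n ≡⟨ cong (_% n) (ℕ.+-comm (c * n) (toℕ i)) ⟩
    (toℕ i + c * n) % n ≡⟨ [m+kn]%n≡m%n (toℕ i) c n ⟩
    toℕ i % n           ≡⟨ m<n⇒m%n≡m (Fin.toℕ<n i) ⟩
    toℕ i               ∎)
    where open ≡-Reasoning

  -- The cyclic predecessor of a vertex.
  prev : Fin n → Fin n
  prev i = fold i next (pred n)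

  next-prev : ∀ i → next (prev i) ≡ i
  next-prev i = trans (cong (fold i next) (trans (ℕ.suc-pred n) (sym (ℕ.*-identityˡ n))))
                      (next^-multiple i 1)

  prev-next : ∀ i → prev (next i) ≡ i
  prev-next i = trans (Arcs.^∙-suc next i (pred n)) (next-prev i)

  next-injective : ∀ {i j} → next i ≡ next j → i ≡ j
  next-injective eq = trans (sym (prev-next _)) (trans (cong prev eq) (prev-next _))

  -- Two steps forward: j and σ j are the two neighbours of next j.
  σ : Fin n → Fin n
  σ i = next (next i)

  σ^≡next^ : ∀ i k → fold i σ k ≡ fold i next (k * 2)
  σ^≡next^ i zero    = refl
  σ^≡next^ i (suc k) = cong σ (σ^≡next^ i k)

  -- Two steps lead back to the start only if n divides 2.
  i≢σi : ∀ {i} → i ≢ σ i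
  i≢σi {i} eq = >⇒∤ 3≤n (next^-return i 2 (sym eq))

  edge⇒next : ∀ {i j} → CycleEdge n i j → j ≡ next i ⊎ i ≡ next j
  edge⇒next {i} {j} (inj₁ j≡1+i) = inj₁ (Fin.toℕ-injective (begin
    toℕ j             ≡⟨ m<n⇒m%n≡m (Fin.toℕ<n j) ⟨
    toℕ j % n         ≡⟨ cong (_% n) j≡1+i ⟩
    suc (toℕ i) % n   ≡⟨ toℕ-mod (suc (toℕ i)) ⟨
    toℕ (next i)      ∎))
    where open ≡-Reasoning
  edge⇒next {i} {j} (inj₂ (i≡0 , 1+j≡n)) = inj₂ (Fin.toℕ-injective (begin
    toℕ i             ≡⟨ i≡0 ⟩
    0                 ≡⟨ n%n≡0 n ⟨
    n % n             ≡⟨ cong (_% n) 1+j≡n ⟨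
    suc (toℕ j) % n   ≡⟨ toℕ-mod (suc (toℕ j)) ⟨
    toℕ (next j)      ∎))
    where open ≡-Reasoning

  ~next : ∀ i → i ~ next i
  ~next i with ℕ.m≤n⇒m<n∨m≡n (Fin.toℕ<n i)
  ... | inj₁ 1+i<n = inj₁ (inj₁ (trans (toℕ-mod (suc (toℕ i))) (m<n⇒m%n≡m 1+i<n)))
  ... | inj₂ 1+i≡n = inj₂ (inj₂
    (trans (toℕ-mod (suc (toℕ i))) (trans (cong (_% n) 1+i≡n) (n%n≡0 n)) , 1+i≡n))

  ~next⇔ : ∀ j k → k ~ next j ⇔ (k ≡ j ⊎ k ≡ σ j)
  ~next⇔ j k = mk⇔ neighbour λ { (inj₁ refl) → ~next j ; (inj₂ refl) → ~-sym (~next (next j)) }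
    where
    fromEdge : next j ≡ next k ⊎ k ≡ next (next j) → k ≡ j ⊎ k ≡ σ j
    fromEdge (inj₁ eq) = inj₁ (sym (next-injective eq))
    fromEdge (inj₂ eq) = inj₂ eq
    neighbour : k ~ next j → k ≡ j ⊎ k ≡ σ j
    neighbour (inj₁ e) = fromEdge (edge⇒next e)
    neighbour (inj₂ e) = fromEdge (swap (edge⇒next e))

  -- The codeword generated by a set of vertices.
  cw : 𝔽₂^ n → 𝔽₂^ (n + n)
  cw = codeword G

  lookup-cw-next : ∀ S j → lookup (cw S) (n ↑ʳ next j) ≡ lookup S j xor lookup S (σ j)
  lookup-cw-next S j = lookup-codeword-deg2 G i≢σi (~next⇔ j) S

  -- Each coordinate of the code is a coordinate of the identity block, or one of the adjacency
  -- block indexed by the vertex between j and σ j.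
  data Position : Fin (n + n) → Set where
    left  : ∀ i → Position (i ↑ˡ n)
    right : ∀ j → Position (n ↑ʳ next j)

  position : ∀ x → Position x
  position x with splitAt n x in eq
  ... | inj₁ i = subst Position (Fin.splitAt⁻¹-↑ˡ eq) (left i)
  ... | inj₂ j = subst Position (trans (cong (n ↑ʳ_) (next-prev j)) (Fin.splitAt⁻¹-↑ʳ eq))
                   (right (prev j))

  xor-≡0₂ : ∀ {a b} → a ≡ b → a xor b ≡ 0₂
  xor-≡0₂ {a} refl = Bool.xor-same a

  xor-≢1₂ : ∀ {a b} → ¬ a xor b ≡ 1₂ → a ≡ b
  xor-≢1₂ {0₂} {0₂} _ = refl
  xor-≢1₂ {0₂} {1₂} f = contradiction refl f
  xor-≢1₂ {1₂} {0₂} f = contradiction refl f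
  xor-≢1₂ {1₂} {1₂} _ = refl

  cw∋left⁺ : ∀ S i → S ∋ i → cw S ∋ i ↑ˡ n
  cw∋left⁺ S i = trans (lookup-codeword-↑ˡ G S i)

  cw∋left⁻ : ∀ S i → cw S ∋ i ↑ˡ n → S ∋ i
  cw∋left⁻ S i = trans (sym (lookup-codeword-↑ˡ G S i))

  -- Comparing the identity blocks gives T ⊑ S; comparing the adjacency blocks gives Coarser.
  cw-⊑⁺ : ∀ T S → T ⊑ S → Coarser σ T S → cw T ⊑ cw S
  cw-⊑⁺ T S T⊑S coarser x with position x
  ... | left i  = cw∋left⁺ S i ∘ T⊑S i ∘ cw∋left⁻ T i
  ... | right j = λ ∋x → Bool.¬-not λ ∌x → contradiction
    (trans (sym ∋x) (trans (lookup-cw-next T j) (xor-≡0₂ (coarser j (xor-≢1₂ λ ∋S →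
      contradiction (trans (sym ∋S) (trans (sym (lookup-cw-next S j)) ∌x)) λ ())))))
    λ ()

  cw-⊑⁻ : ∀ T S → cw T ⊑ cw S → T ⊑ S × Coarser σ T S
  cw-⊑⁻ T S cwT⊑cwS =
    (λ i → cw∋left⁻ S i ∘ cwT⊑cwS (i ↑ˡ n) ∘ cw∋left⁺ T i) ,
    λ j same → xor-≢1₂ λ ∋T → contradiction
      (trans (sym (xor-≡0₂ same)) (trans (sym (lookup-cw-next S j))
        (cwT⊑cwS _ (trans (lookup-cw-next T j) ∋T))))
      λ ()

  cw≢0ᵛ⇒∋ : ∀ S → cw S ≢ 0ᵛ → ∃ (S ∋_)
  cw≢0ᵛ⇒∋ S cw≢0 with ≢0ᵛ⇒∋ cw≢0
  ... | x , ∋x with position x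
  ...   | left i  = i , cw∋left⁻ S i ∋x
  ...   | right j with lookup S j in ∋j | lookup S (σ j) in ∋σj | trans (sym (lookup-cw-next S j)) ∋x
  ...     | 1₂ | _  | _ = j , ∋j
  ...     | 0₂ | 1₂ | _ = σ j , ∋σj

  ∋⇒cw≢0ᵛ : ∀ S → ∃ (S ∋_) → cw S ≢ 0ᵛ
  ∋⇒cw≢0ᵛ S (i , S∋i) = ∋⇒≢0ᵛ (cw∋left⁺ S i S∋i)

  cw-minimal⇔ : ∀ S → Minimal (codeOf G) (cw S) ⇔ Indecomposable σ S
  cw-minimal⇔ S = mk⇔ indecomposable minimal
    where
    open Equivalence
    minimal : Indecomposable σ S → Minimal (codeOf G) (cw S)
    minimal (S∋ , least) = (S , refl) , ∋⇒cw≢0ᵛ S S∋ , none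
      where
      none : ¬ ∃ λ c′ → codeOf G c′ × c′ ≢ 0ᵛ × supp c′ ⊂ supp (cw S)
      none (_ , (T , refl) , cwT≢0 , ⊂) with cwT⊑cwS , x , ∋x , ∌x ← to supp-⊂⇔ ⊂
        with T⊑S , coarser ← cw-⊑⁻ T S cwT⊑cwS
        with refl ← least T (cw≢0ᵛ⇒∋ T cwT≢0) T⊑S coarser = ∌x ∋x
    indecomposable : Minimal (codeOf G) (cw S) → Indecomposable σ S
    indecomposable (_ , cw≢0 , none) = cw≢0ᵛ⇒∋ S cw≢0 , λ T T∋ T⊑S coarser →
      ⊑-antisym T⊑S λ i S∋i → Bool.¬-not λ T∌i → none
        (cw T , (T , refl) , ∋⇒cw≢0ᵛ T T∋ , from supp-⊂⇔
          (cw-⊑⁺ T S T⊑S coarser , i ↑ˡ n , cw∋left⁺ S i S∋i ,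
           λ ∋i → contradiction (trans (sym T∌i) (cw∋left⁻ T i ∋i)) λ ()))

  M-enumeration : ∀ {L} → Unique L → (∀ {S} → S List.∈ L ⇔ Indecomposable σ S) → M G ≡ length L
  M-enumeration {L} unique L⇔ = trans
    (numberOf-enumeration (minimal? (codeOf? G))
      (Unique.map⁺ (λ {S} {T} → codeword-injective G {S} {T}) unique)
      (mk⇔ sound complete))
    (List.length-map cw L)
    where
    open Equivalence
    sound : ∀ {c} → c List.∈ List.map cw L → Minimal (codeOf G) c
    sound c∈ with S , S∈L , refl ← ∈-map⁻ cw c∈ = from (cw-minimal⇔ S) (to L⇔ S∈L)
    complete : ∀ {c} → Minimal (codeOf G) c → c List.∈ List.map cw L
    complete min@((S , refl) , _) = ∈-map⁺ cw (from L⇔ (to (cw-minimal⇔ S) min))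

  -- Counting orbits and arcs of the two-step permutation

  -- The hypotheses say that suc q is the least positive k with n dividing 2 k, and that reps
  -- has exactly one element in each orbit of σ.
  M-orbits : ∀ q (reps : List (Fin n)) →
    n ∣ suc q * 2 → (∀ {k} → 0 < k → k ≤ q → ¬ n ∣ k * 2) →
    AllPairs (λ r r′ → ∀ k → fold r σ k ≢ r′) reps →
    (∀ i → ∃ λ r → r List.∈ reps × ∃ λ k → fold r σ k ≡ i) →
    M G ≡ length reps + n * q
  M-orbits q reps (divides c 2p≡cn) noReturn distinct covering =
    trans (M-enumeration indecomposables-unique ∈-indecomposables) length-indecomposables
    where
    open FreeOrbits σ q
      (λ i → trans (σ^≡next^ i (suc q)) (trans (cong (fold i next) 2p≡cn) (next^-multiple i c)))
      (λ i {k} 0<k k≤q eq → noReturn 0<k k≤q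
        (next^-return i (k * 2) (trans (sym (σ^≡next^ i k)) eq)))
    open Enumeration reps distinct covering

  σ^mod≡ : ∀ r k i → r < n → (k * 2 + r) % n ≡ toℕ i → fold (r mod n) σ k ≡ i
  σ^mod≡ r k i r<n eq = Fin.toℕ-injective (begin
    toℕ (fold (r mod n) σ k)           ≡⟨ cong toℕ (σ^≡next^ (r mod n) k) ⟩
    toℕ (fold (r mod n) next (k * 2))  ≡⟨ toℕ-next^ (r mod n) (k * 2) ⟩
    (k * 2 + toℕ (r mod n)) % n        ≡⟨ cong (λ x → (k * 2 + x) % n)
                                            (trans (toℕ-mod r) (m<n⇒m%n≡m r<n)) ⟩
    (k * 2 + r) % n                    ≡⟨ eq ⟩
    toℕ i                              ∎)
    where open ≡-Reasoning

  -- For odd n, every vertex i lies in the orbit of 0, as 2 (i (n + 1) / 2) = i + i n.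
  M-odd : n % 2 ≢ 0 → M G ≡ 1 + n * pred n
  M-odd odd = M-orbits (pred n) (0 mod n ∷ [])
    (divides 2 (trans (cong (_* 2) (ℕ.suc-pred n)) (ℕ.*-comm n 2)))
    (λ {k} 0<k k≤q → noReturn 0<k (ℕ.<-≤-trans (s≤s k≤q) (ℕ.≤-reflexive (ℕ.suc-pred n))))
    ([] ∷ [])
    λ i → 0 mod n , here refl , toℕ i * suc (n / 2) , σ^mod≡ 0 (toℕ i * suc (n / 2)) i
      (ℕ.≤-trans (s≤s z≤n) 3≤n) (half i)
    where
    n%2≡1 : n % 2 ≡ 1
    n%2≡1 = ℕ.≤-antisym (s≤s⁻¹ (m%n<n n 2)) (ℕ.n≢0⇒n>0 odd)
    -- If 2 k = c n with n odd, then c is even and n divides k.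
    noReturn : ∀ {k} → 0 < k → k < n → ¬ n ∣ k * 2
    noReturn {k} 0<k k<n (divides c 2k≡cn) with euclidsLemma c n prime[2] (divides k (sym 2k≡cn))
    ... | inj₂ 2∣n = odd (n∣m⇒m%n≡0 n 2 2∣n)
    ... | inj₁ (divides d refl) = >⇒∤ {{>-nonZero 0<k}} k<n (divides d
      (ℕ.*-cancelʳ-≡ k (d * n) 2 (trans 2k≡cn (trans (ℕ.*-assoc d 2 n)
        (trans (cong (d *_) (ℕ.*-comm 2 n)) (sym (ℕ.*-assoc d n 2)))))))
    half : ∀ i → (toℕ i * suc (n / 2) * 2 + 0) % n ≡ toℕ i
    half i = begin
      (toℕ i * suc (n / 2) * 2 + 0) % n  ≡⟨ cong (_% n) (ℕ.+-identityʳ _) ⟩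
      (toℕ i * suc (n / 2) * 2) % n      ≡⟨ cong (_% n) (ℕ.*-assoc (toℕ i) (suc (n / 2)) 2) ⟩
      (toℕ i * suc (1 + n / 2 * 2)) % n  ≡⟨ cong (λ x → (toℕ i * suc x) % n)
                                              (trans (cong (_+ n / 2 * 2) (sym n%2≡1))
                                                     (sym (m≡m%n+[m/n]*n n 2))) ⟩
      (toℕ i * suc n) % n                ≡⟨ cong (_% n) (ℕ.*-suc (toℕ i) n) ⟩
      (toℕ i + toℕ i * n) % n            ≡⟨ [m+kn]%n≡m%n (toℕ i) (toℕ i) n ⟩
      toℕ i % n                          ≡⟨ m<n⇒m%n≡m (Fin.toℕ<n i) ⟩
      toℕ i                              ∎
      where open ≡-Reasoning

  -- For even n, the orbits consist of the vertices of one parity.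
  M-even : ∀ q → n ≡ suc q * 2 → M G ≡ 2 + n * q
  M-even q n≡2p = M-orbits q (0 mod n ∷ 1 mod n ∷ [])
    (subst (_∣ suc q * 2) (sym n≡2p) ∣-refl)
    noReturn
    ((distinct ∷ []) ∷ [] ∷ [])
    covering
    where
    noReturn : ∀ {k} → 0 < k → k ≤ q → ¬ n ∣ k * 2
    noReturn {k} 0<k k≤q n∣2k = >⇒∤ {{>-nonZero 0<k}} (s≤s k≤q)
      (*-cancelʳ-∣ 2 (subst (_∣ k * 2) n≡2p n∣2k))
    1<n : 1 < n
    1<n = ℕ.≤-trans (s≤s (s≤s z≤n)) 3≤n
    -- Reduction modulo the even number n preserves parity.
    distinct : ∀ k → fold (0 mod n) σ k ≢ 1 mod n
    distinct k eq = contradiction 0≡1 λ ()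
      where
      open ≡-Reasoning
      0≡1 : 0 ≡ 1
      0≡1 = begin
        0                                     ≡⟨ m*n%n≡0 k 2 ⟨
        (k * 2) % 2                           ≡⟨ cong (_% 2) (ℕ.+-identityʳ (k * 2)) ⟨
        (k * 2 + 0) % 2                       ≡⟨ m∣n⇒o%n%m≡o%m 2 n (k * 2 + 0) (divides (suc q) n≡2p) ⟨
        (k * 2 + 0) % n % 2                   ≡⟨ cong (λ x → (k * 2 + x) % n % 2)
                                                   (trans (toℕ-mod 0) (m<n⇒m%n≡m (ℕ.<⇒≤ 1<n))) ⟨
        (k * 2 + toℕ (0 mod n)) % n % 2       ≡⟨ cong (_% 2) (toℕ-next^ (0 mod n) (k * 2)) ⟨
        toℕ (fold (0 mod n) next (k * 2)) % 2 ≡⟨ cong (λ x → toℕ x % 2)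
                                                   (trans (sym (σ^≡next^ (0 mod n) k)) eq) ⟩
        toℕ (1 mod n) % 2                     ≡⟨ cong (_% 2) (trans (toℕ-mod 1) (m<n⇒m%n≡m 1<n)) ⟩
        1                                     ∎
    covering : ∀ i → ∃ λ r → r List.∈ (0 mod n ∷ 1 mod n ∷ []) × ∃ λ k → fold r σ k ≡ i
    covering i with toℕ i % 2 | m%n<n (toℕ i) 2 | m≡m%n+[m/n]*n (toℕ i) 2
    ... | r@0 | _ | eq = r mod n , here refl , toℕ i / 2 , σ^mod≡ r (toℕ i / 2) i (ℕ.<⇒≤ 1<n)
      (trans (cong (_% n) (trans (ℕ.+-comm (toℕ i / 2 * 2) r) (sym eq))) (m<n⇒m%n≡m (Fin.toℕ<n i)))
    ... | r@1 | _ | eq = r mod n , there (here refl) , toℕ i / 2 , σ^mod≡ r (toℕ i / 2) i 1<n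
      (trans (cong (_% n) (trans (ℕ.+-comm (toℕ i / 2 * 2) r) (sym eq))) (m<n⇒m%n≡m (Fin.toℕ<n i)))
    ... | suc (suc _) | s≤s (s≤s ()) | _

-- The closed formulas

even-formula : ∀ q → let n = suc q * 2 in 2 + n * q ≡ (n ^ 2 ∸ 2 * n + 4) / 2
even-formula q = sym (begin
  (n ^ 2 ∸ 2 * n + 4) / 2          ≡⟨ cong (λ x → (x ∸ 2 * n + 4) / 2) (square q) ⟩
  (n * q * 2 + 2 * n ∸ 2 * n + 4) / 2 ≡⟨ cong (λ x → (x + 4) / 2) (ℕ.m+n∸n≡m (n * q * 2) (2 * n)) ⟩
  (n * q * 2 + 4) / 2              ≡⟨ cong (_/ 2) (ℕ.+-comm (n * q * 2) 4) ⟩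
  (2 + n * q) * 2 / 2              ≡⟨ m*n/n≡m (2 + n * q) 2 ⟩
  2 + n * q                        ∎)
  where
  open ≡-Reasoning
  n = suc q * 2
  square : ∀ q → (1 + q) * 2 * ((1 + q) * 2 * 1) ≡ (1 + q) * 2 * q * 2 + 2 * ((1 + q) * 2)
  square = solve-∀

odd-formula : ∀ q → let n = suc q in 1 + n * q ≡ n ^ 2 ∸ n + 1
odd-formula q = sym (begin
  n ^ 2 ∸ n + 1       ≡⟨ cong (λ x → x ∸ n + 1) (square q) ⟩
  n * q + n ∸ n + 1   ≡⟨ cong (_+ 1) (ℕ.m+n∸n≡m (n * q) n) ⟩
  n * q + 1           ≡⟨ ℕ.+-comm (n * q) 1 ⟩
  1 + n * q           ∎)
  where
  open ≡-Reasoning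
  n = suc q
  square : ∀ q → (1 + q) * ((1 + q) * 1) ≡ (1 + q) * q + (1 + q)
  square = solve-∀

proposition3p7 : (n : ℕ) (3≤n : 3 ≤ n) →
    (n % 2 ≡ 0 → M (cycle n 3≤n) ≡ (n ^ 2 ∸ 2 * n + 4) / 2) ×
    (n % 2 ≢ 0 → M (cycle n 3≤n) ≡ n ^ 2 ∸ n + 1)
proposition3p7 n@(suc q) 3≤n = even , λ odd → trans (Cycle.M-odd n 3≤n odd) (odd-formula q)
  where
  even : n % 2 ≡ 0 → M (cycle n 3≤n) ≡ (n ^ 2 ∸ 2 * n + 4) / 2
  even n%2≡0 with m%n≡0⇒n∣m n 2 n%2≡0
  ... | divides (suc p) n≡2p = trans (Cycle.M-even n 3≤n p n≡2p)
    (trans (cong (λ x → 2 + x * p) n≡2p)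
      (trans (even-formula p) (cong (λ x → (x ^ 2 ∸ 2 * x + 4) / 2) (sym n≡2p))))
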